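{- Let $\kappa$ be a regular uncountable cardinal and $\lambda>\kappa$ a cardinal. Suppose that $\rho\in\mathcal K(\kappa,\lambda)$ and $\rho\ge\overline{\mathfrak d}_\kappa$. Then it is not the case that $I_{\kappa,\lambda}^+\xrightarrow{\kappa}[I_{\kappa,\lambda}^+]^2_\rho$.
   Context: For a cardinal $\mu$ and a set $A$, $P_\mu(A)=\{a\subseteq A:|a|<\mu\}$. $I_{\kappa,\lambda}$ is the set of all $A\subseteq P_\kappa(\lambda)$ such that $A\cap\{b\in P_\kappa(\lambda):a\subseteq b\}=\emptyset$ for some $a\in P_\kappa(\lambda)$; $I_{\kappa,\lambda}^+$ is the set of subsets of $P_\kappa(\lambda)$ not in $I_{\kappa,\lambda}$. $\mathcal K(\kappa,\lambda)$ is the set of all cardinals $\sigma\ge\lambda$ for which there is $T\subseteq P_\kappa(\lambda)$ with $|T|=\sigma$ and $|T\cap P(a)|<\kappa$ for every $a\in P_\kappa(\lambda)$. (In particular $\lambda\in\mathcal K(\kappa,\lambda)$.) $\overline{\mathfrak d}_\kappa$ is the least cardinality of an $X\subseteq{}^\kappa\kappa$ such that for every $g\in{}^\kappa\kappa$ there is $x\in P_\kappa(X)$ with $g(\alpha)<\bigcup_{f\in x}f(\alpha)$ for all $\alpha<\kappa$. For $A\subseteq P_\kappa(\lambda)$, $[A]^2_\kappa=\{(\bigcup(a\cap\kappa),b):a,b\in A,\ \bigcup(a\cap\kappa)<\bigcup(b\cap\kappa)\}$. For a cardinal $\rho$ with $2\le\rho\le\lambda^{<\kappa}$, $I_{\kappa,\lambda}^+\xrightarrow{\kappa}[I_{\kappa,\lambda}^+]^2_\rho$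 means: for every $F:[P_\kappa(\lambda)]^2_\kappa\to\rho$ and every $A\in I_{\kappa,\lambda}^+$ there is $B\in I_{\kappa,\lambda}^+\cap P(A)$ such that $F''[B]^2_\kappa\ne\rho$. -}

module Defs where

open import Level using (Level) renaming (suc to lsuc)
open import Axiom.ExcludedMiddle using (ExcludedMiddle)
open import Data.Bool using (Bool; true; T; _∧_)
open import Data.Nat using (ℕ)
open import Data.Product using (Σ; Σ-syntax; _×_; _,_; proj₁)
open import Data.Sum using (_⊎_)
open import Function using (_↣_; _⤖_)
open import Induction.WellFounded using (WellFounded)
open import Relation.Binary using (Rel; IsStrictTotalOrder)
open import Relation.Binary.PropositionalEquality using (_≡_)
open import Relation.Nullary using (¬_)
open import Relation.Nullary.Decidable using (⌊_⌋)

private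
  variable
    a b : Level
    A : Set a

-- Sets are modelled by types under _≡_, and the subsets of a type by their
-- characteristic functions.  Membership in a Bool-valued subset is
-- proof-irrelevant, so El S has exactly as many elements as S, and under
-- function extensionality subsets with the same members are equal.
-- ⟦_⟧ below uses excluded middle to turn any property into a subset.

Subset : Set a → Set a
Subset A = A → Bool

infix 4 _∈_ _⊆_ _≼_ _≺_
infixr 7 _∩_

_∈_ : A → Subset A → Set
x ∈ S = T (S x)

_⊆_ : {A : Set a} → Subset A → Subset A → Set a
R ⊆ S = ∀ x → x ∈ R → x ∈ S

_∩_ : Subset A → Subset A → Subset A
(R ∩ S) x = R x ∧ S x

full : Subset A
full _ = true

El : {A : Set a} → Subset A → Set a
El {A = A} S = Σ[ x ∈ A ] x ∈ S

-- Comparison of cardinalities: A ≼ B is |A| ≤ |B| and A ≺ B is |A| < |B|.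

_≼_ : Set a → Set b → Set _
A ≼ B = A ↣ B

_≺_ : Set a → Set b → Set _
A ≺ B = (A ≼ B) × ¬ (B ≼ A)

-- Excluded middle for types, in which existence is Σ, also yields choice:
-- a function choosing an element of every nonempty subset S of A is obtained
-- by deciding El S.  So the background theory is classical, with choice.

module Classical {ℓ : Level} (lem : ExcludedMiddle ℓ) where

  ⟦_⟧ : {A : Set a} → (A → Set ℓ) → Subset A
  ⟦ P ⟧ x = ⌊ lem {P x} ⌋

  -- Pow< M S is P_μ(S) = {x ⊆ S : |x| < μ}, where μ = |M|.

  Pow< : {A : Set ℓ} → Set ℓ → Subset A → Subset (Subset A)
  Pow< M S = ⟦ (λ x → x ⊆ S × El x ≺ M) ⟧

  -- A cardinal is an initial ordinal: a well-ordered type all of whose proper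
  -- initial segments have smaller cardinality.  As with von Neumann ordinals,
  -- an element α stands for the ordinal seg α of its predecessors.

  record Cardinal : Set (lsuc ℓ) where
    field
      Carrier            : Set ℓ
      _<_                : Rel Carrier ℓ
      isStrictTotalOrder : IsStrictTotalOrder _≡_ _<_
      wellFounded        : WellFounded _<_

    seg : Carrier → Subset Carrier
    seg α = ⟦ (λ β → β < α) ⟧

    -- The union of a set of ordinals, as the set of the ordinals in it.
    ⋃ : Subset Carrier → Subset Carrier
    ⋃ S = ⟦ (λ β → Σ[ γ ∈ Carrier ] γ ∈ S × β < γ) ⟧

    field
      initial : ∀ α → El (seg α) ≺ Carrier

  open Cardinal using (Carrier)

  -- Λ is the cardinal λ.  Since κ < λ means κ ∈ λ, the cardinal κ is given as
  -- an element of Λ, whose predecessors form the type Kappa.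

  module _ (Λ : Cardinal) (κ : Carrier Λ) where

    open Cardinal Λ using (_<_; seg; ⋃) renaming (Carrier to L)

    Kappa : Set ℓ
    Kappa = El (seg κ)

    IsCardinal : Set ℓ
    IsCardinal = ∀ β → β < κ → El (seg β) ≺ Kappa

    Cofinal : Subset L → Set ℓ
    Cofinal x = x ⊆ seg κ ×
      (∀ α → α < κ → Σ[ β ∈ L ] β ∈ x × (α < β ⊎ α ≡ β))

    IsRegular : Set ℓ
    IsRegular = ℕ ≼ Kappa × (∀ x → Cofinal x → ¬ (El x ≺ Kappa))

    IsUncountable : Set ℓ
    IsUncountable = ℕ ≺ Kappa

    Pκλ : Subset (Subset L)
    Pκλ = Pow< Kappa full

    -- Membership in I_{κ,λ} and in I_{κ,λ}^+.

    I : Subset (Subset L) → Set ℓ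
    I A = A ⊆ Pκλ ×
      (Σ[ a ∈ Subset L ] a ∈ Pκλ × ¬ (Σ[ b ∈ Subset L ] b ∈ A × b ∈ Pκλ × a ⊆ b))

    I⁺ : Subset (Subset L) → Set ℓ
    I⁺ A = A ⊆ Pκλ × ¬ I A

    -- Membership in 𝒦(κ,λ).

    𝒦 : Cardinal → Set ℓ
    𝒦 σ = L ≼ Carrier σ ×
      (Σ[ 𝒯 ∈ Subset (Subset L) ] 𝒯 ⊆ Pκλ × El 𝒯 ⤖ Carrier σ ×
        (∀ a → a ∈ Pκλ → El (𝒯 ∩ ⟦ (λ t → t ⊆ a) ⟧) ≺ Kappa))

    -- g(α) < ⋃_{f∈x} f(α) is membership of g(α) in the union, that is,
    -- g(α) < f(α) for some f ∈ x.

    Dominating : Subset (Kappa → Kappa) → Set ℓ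
    Dominating X = ∀ (g : Kappa → Kappa) →
      Σ[ x ∈ Subset (Kappa → Kappa) ] x ∈ Pow< Kappa X ×
        (∀ α → Σ[ f ∈ (Kappa → Kappa) ] f ∈ x × proj₁ (g α) < proj₁ (f α))

    -- δ is the cardinal 𝔡̄_κ.

    Is𝔡̄ : Cardinal → Set ℓ
    Is𝔡̄ δ =
      (Σ[ X ∈ Subset (Kappa → Kappa) ] Dominating X × El X ⤖ Carrier δ) ×
      (∀ X → Dominating X → Carrier δ ≼ El X)

    -- The set [A]²_κ: an ordinal α equals ⋃(a ∩ κ) when seg α does, and
    -- α < ⋃(b ∩ κ) is membership.

    [_]² : Subset (Subset L) → Subset (L × Subset L)
    [ A ]² = ⟦ (λ (α , b) → Σ[ a ∈ Subset L ] a ∈ A × b ∈ A ×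
                 seg α ≡ ⋃ (a ∩ seg κ) × α ∈ ⋃ (b ∩ seg κ)) ⟧

    -- The relation I⁺ —κ→ [I⁺]²_ρ.  The last conjunct is F''[B]² ≠ ρ.  The
    -- restriction 2 ≤ ρ ≤ λ^{<κ} under which the arrow is usually written is
    -- not part of it; every ρ in 𝒦(κ,λ) satisfies it.

    Arrow : Cardinal → Set ℓ
    Arrow ρ = (F : El [ Pκλ ]² → Carrier ρ) → ∀ A → I⁺ A →
      Σ[ B ∈ Subset (Subset L) ] I⁺ B × B ⊆ A ×
        ¬ (∀ c → Σ[ p ∈ El [ Pκλ ]² ] proj₁ p ∈ [ B ]² × F p ≡ c)

{-# OPTIONS --safe #-}
module Submission where

-- Let 𝒯 witness ρ ∈ 𝒦(κ,λ), with t ↦ θ t a bijection from 𝒯 to ρ and t ↦ φ t a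
-- surjection from 𝒯 to a dominating family X.  A set a in P_κ(λ) contains fewer
-- than κ members of 𝒯, so h = sup {φ t : t ⊆ a} is a function from κ to κ, and κ
-- splits into κ many levels each of which contains an interval [ξ , h ξ).
-- Assign different levels to the t ⊆ a, and let F(α,b) be θ t if α lies in the
-- level assigned to t with respect to a = trim b.  A consists of the b such
-- that some γ ∈ b ∩ κ bounds all levels assigned with respect to trim b.  Given B ⊆ A in
-- I⁺, let next ξ be some ⋃(b ∩ κ) ≥ ξ with b ∈ B.  Fewer than κ members of X
-- dominate next; if trim b contains their codes, then next ξ < h ξ for all ξ, so
-- every level contains an ordinal ⋃(a ∩ κ) with a ∈ B.  Letting trim b contain
-- in addition a given t, we see that the colour θ t is attained on B.

open import Level using (Level; Lift; lift; lower)
open import Axiom.ExcludedMiddle using (ExcludedMiddle)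
open import Axiom.Extensionality.Propositional
  using (Extensionality; lower-extensionality)
open import Data.Bool using (true; false; T)
open import Data.Bool.Properties using (T-irrelevant; T-∧)
open import Data.Empty using (⊥-elim)
open import Data.Fin using (Fin; zero; suc; toℕ)
open import Data.Fin.Properties using (toℕ-injective; ℕ→Fin-notInjective)
open import Data.Product using (Σ; Σ-syntax; _×_; _,_; proj₁; proj₂)
open import Data.Sum using (_⊎_; inj₁; inj₂)
open import Function
  using (mk↣; Injection; Bijection; Equivalence; _on_; _∘_)
open import Function.Construct.Composition using (injection)
open import Function.Construct.Symmetry using (⤖-sym)
open import Induction.WellFounded using (WellFounded; Acc; acc)
open import Relation.Binary using (Rel; IsStrictTotalOrder; tri<; tri≈; tri>)
import Relation.Binary.Construct.On as On
open import Relation.Binary.PropositionalEquality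
  using (_≡_; refl; sym; trans; cong; subst)
open import Relation.Nullary using (¬_; yes; no)
open import Relation.Nullary.Decidable using (⌊_⌋; toWitness; fromWitness; decidable-stable)
open import Defs

-- Sim R S u α says that the R-rank of u is at most the S-rank of α.
data Sim {ℓ} {A B : Set ℓ} (R : Rel A ℓ) (S : Rel B ℓ) : A → B → Set ℓ where
  sim : ∀ {u α} → (∀ v → R v u → Σ[ β ∈ B ] S β α × Sim R S v β) → Sim R S u α

unsim : ∀ {ℓ} {A B : Set ℓ} {R : Rel A ℓ} {S : Rel B ℓ} {u α} →
  Sim R S u α → ∀ v → R v u → Σ[ β ∈ B ] S β α × Sim R S v β
unsim (sim s) = s

-- Subsets and comparison of cardinalities.

El-≡ : ∀ {a} {A : Set a} {S : Subset A} {x y : El S} → proj₁ x ≡ proj₁ y → x ≡ y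
El-≡ {x = _ , p} {y = _ , q} refl = cong (_ ,_) (T-irrelevant p q)

abstract
  ∩-intro : ∀ {a} {A : Set a} (R S : Subset A) {x} → x ∈ R → x ∈ S → x ∈ R ∩ S
  ∩-intro R S p q = Equivalence.from T-∧ (p , q)

  ∩-elim : ∀ {a} {A : Set a} (R S : Subset A) {x} → x ∈ R ∩ S → x ∈ R × x ∈ S
  ∩-elim R S = Equivalence.to T-∧

El-mono : ∀ {a} {A : Set a} {R S : Subset A} → R ⊆ S → El R ≼ El S
El-mono i = mk↣ {to = λ (x , p) → x , i x p} (λ e → El-≡ (cong proj₁ e))

T-ext : ∀ {p q} → (T p → T q) → (T q → T p) → p ≡ q
T-ext {false} {false} _ _ = refl
T-ext {true}  {true}  _ _ = refl
T-ext {true}  {false} f _ = ⊥-elim (f _)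
T-ext {false} {true}  _ g = ⊥-elim (g _)

≺-respˡ-≼ : ∀ {a b c} {A : Set a} {B : Set b} {C : Set c} → A ≼ B → B ≺ C → A ≺ C
≺-respˡ-≼ i (j , k) = injection i j , λ e → k (injection e i)

-- Classical reasoning and choice.

module Reasoning {ℓ : Level} (lem : ExcludedMiddle ℓ) (ext : Extensionality ℓ ℓ) where

  open Classical lem

  by-contradiction : {P : Set ℓ} → ¬ ¬ P → P
  by-contradiction = decidable-stable lem

  ¬∀⇒∃¬ : {A : Set ℓ} {P : A → Set ℓ} → ¬ (∀ x → P x) → Σ[ x ∈ A ] ¬ P x
  ¬∀⇒∃¬ n = by-contradiction λ k → n λ x → by-contradiction λ np → k (x , np)

  abstract
    ⟦⟧-intro : {Q : Set ℓ} → Q → T ⌊ lem {Q} ⌋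
    ⟦⟧-intro = fromWitness

    ⟦⟧-elim : {Q : Set ℓ} → T ⌊ lem {Q} ⌋ → Q
    ⟦⟧-elim = toWitness

  ⊆-antisym : {A : Set ℓ} {R S : Subset A} → R ⊆ S → S ⊆ R → R ≡ S
  ⊆-antisym i j = lower-extensionality ℓ ℓ ext λ x → T-ext (i x) (j x)

  abstract
    least : {A : Set ℓ} {_<_ : Rel A ℓ} → WellFounded _<_ → (P : A → Set ℓ) →
      Σ A P → Σ[ x ∈ A ] P x × (∀ y → y < x → ¬ P y)
    least {A} {_<_} wf P (x , p) = go x (wf x) p
      where
      go : ∀ x → Acc _<_ x → P x → Σ[ x ∈ A ] P x × (∀ y → y < x → ¬ P y)
      go x (acc rs) p with lem {Σ[ y ∈ A ] y < x × P y}
      ... | yes (y , y<x , q) = go y (rs y<x) q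
      ... | no n = x , p , λ y y<x q → n (y , y<x , q)

    -- This turns |X| ≤ |𝒯| into a surjection from 𝒯 onto X. Off the image of `i` the value is the
    -- default `x₀`.
    retraction : {A B : Set ℓ} → A ≼ B → A →
      Σ[ r ∈ (B → A) ] (∀ x → Σ[ y ∈ B ] r y ≡ x)
    retraction {A} {B} i x₀ = r , λ x → Injection.to i x , r-to x
      where
      r : B → A
      r y with lem {Σ[ x ∈ A ] Injection.to i x ≡ y}
      ... | yes (x , _) = x
      ... | no _ = x₀
      r-to : ∀ x → r (Injection.to i x) ≡ x
      r-to x with lem {Σ[ z ∈ A ] Injection.to i z ≡ Injection.to i x}
      ... | yes (_ , e) = Injection.injective i e
      ... | no n = ⊥-elim (n (x , refl))

  -- Order and regularity of κ.

  module Regular (Λ : Cardinal) (κ : Cardinal.Carrier Λ)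
    (isCardinal : IsCardinal Λ κ) (isRegular : IsRegular Λ κ) where

    open Cardinal Λ using (_<_; seg; ⋃; wellFounded; isStrictTotalOrder)
      renaming (Carrier to L)
    open IsStrictTotalOrder isStrictTotalOrder using (compare; irrefl)
      renaming (trans to <-trans)

    K : Set ℓ
    K = Kappa Λ κ

    𝒫 : Subset (Subset L)
    𝒫 = Pκλ Λ κ

    infix 4 _≤_ _<ᴷ_ _≤ᴷ_

    _≤_ : Rel L ℓ
    x ≤ y = ¬ y < x

    _<ᴷ_ _≤ᴷ_ : Rel K ℓ
    _<ᴷ_ = _<_ on proj₁
    _≤ᴷ_ = _≤_ on proj₁

    <ᴷ-wellFounded : WellFounded _<ᴷ_
    <ᴷ-wellFounded = On.wellFounded proj₁ wellFounded

    ≤-<-trans : ∀ {x y z} → x ≤ y → y < z → x < z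
    ≤-<-trans {x} {y} p q with compare x y
    ... | tri< a _ _ = <-trans a q
    ... | tri≈ _ refl _ = q
    ... | tri> _ _ c = ⊥-elim (p c)

    <-≤-trans : ∀ {x y z} → x < y → y ≤ z → x < z
    <-≤-trans {y = y} {z} p q with compare y z
    ... | tri< a _ _ = <-trans p a
    ... | tri≈ _ refl _ = p
    ... | tri> _ _ c = ⊥-elim (q c)

    ≤-refl : ∀ {x} → x ≤ x
    ≤-refl = irrefl refl

    <⇒≤ : ∀ {x y} → x < y → x ≤ y
    <⇒≤ p q = ≤-refl (<-trans p q)

    abstract
      -- An unbounded `φ` would have a cofinal range, and `range` injects into `I` by a choice of
      -- preimages, against regularity.
      bound : {I : Set ℓ} → I ≺ K → (φ : I → K) → Σ[ ν ∈ K ] (∀ i → φ i <ᴷ ν)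
      bound {I} small φ = by-contradiction λ n → proj₂ isRegular range (cofinal n) range≺K
        where
        range : Subset L
        range = ⟦ (λ α → Σ[ i ∈ I ] proj₁ (φ i) ≡ α) ⟧
        index : El range → I
        index (_ , p) = proj₁ (⟦⟧-elim p)
        index-correct : ∀ x → proj₁ (φ (index x)) ≡ proj₁ x
        index-correct (_ , p) = proj₂ (⟦⟧-elim p)
        range≺K : El range ≺ K
        range≺K = ≺-respˡ-≼ (mk↣ {to = index} λ {x} {y} e → El-≡
          (trans (sym (index-correct x))
            (trans (cong (proj₁ ∘ φ) e) (index-correct y)))) small
        range⊆ : range ⊆ seg κ
        range⊆ α p with ⟦⟧-elim p
        ... | i , refl = proj₂ (φ i)
        cofinal : ¬ (Σ[ ν ∈ K ] (∀ i → φ i <ᴷ ν)) → Cofinal Λ κ range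
        cofinal n = range⊆ , λ α α<κ →
          let i , α≤φi = ¬∀⇒∃¬ (λ b → n ((α , ⟦⟧-intro α<κ) , b))
          in proj₁ (φ i) , ⟦⟧-intro (i , refl) , ≤⇒<⊎≡ α≤φi
          where
          ≤⇒<⊎≡ : ∀ {x y} → x ≤ y → x < y ⊎ x ≡ y
          ≤⇒<⊎≡ {x} {y} p with compare x y
          ... | tri< a _ _ = inj₁ a
          ... | tri≈ _ b _ = inj₂ b
          ... | tri> _ _ c = ⊥-elim (p c)

    -- U is mapped into κ by its rank function: by induction on u, the ranks of the
    -- elements of U below u form a set of size less than κ, hence a bounded one.
    ⋡⇒≺ : (U : Subset L) → ¬ (K ≼ El U) → El U ≺ K
    ⋡⇒≺ U K⋠U = mk↣ {to = rank ranked} (λ {u} {v} → rank-injective ranked) , K⋠U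
      where
      _⊏_ : Rel (El U) ℓ
      _⊏_ = _<_ on proj₁
      _⊑_ : El U → K → Set ℓ
      _⊑_ = Sim _⊏_ _<ᴷ_
      -- `V` is the part of `U` below some u during the recursion, and all of `U` at the end.
      module _ {V : Set ℓ} {inc : V → El U} (sims : ∀ v → Σ[ α ∈ K ] inc v ⊑ α) where
        leastSim : ∀ v → Σ[ α ∈ K ] inc v ⊑ α × (∀ β → β <ᴷ α → ¬ inc v ⊑ β)
        leastSim v = least <ᴷ-wellFounded _ (sims v)
        rank : V → K
        rank v = proj₁ (leastSim v)
        rank-mono : ∀ {v w} → inc v ⊏ inc w → ¬ rank v ≡ rank w
        -- Some β below the rank of w has `inc v ⊑ β`; were the ranks equal, β would be below the
        -- least such ordinal for v.
        rank-mono {v} {w} v<w e with unsim (proj₁ (proj₂ (leastSim w))) (inc v) v<w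
        ... | β , β<rank , s =
          proj₂ (proj₂ (leastSim v)) β (subst (β <ᴷ_) (sym e) β<rank) s
        rank-injective : ∀ {v w} → rank v ≡ rank w → inc v ≡ inc w
        rank-injective {v} {w} e with compare (proj₁ (inc v)) (proj₁ (inc w))
        ... | tri< a _ _ = ⊥-elim (rank-mono a e)
        ... | tri≈ _ b _ = El-≡ b
        ... | tri> _ _ c = ⊥-elim (rank-mono c (sym e))
      rankedAt : ∀ u → Acc _⊏_ u → Σ[ α ∈ K ] u ⊑ α
      rankedAt u (acc rs) = proj₁ ν , sim λ v v<u →
          let v' = v , ⟦⟧-intro v<u in
          rank sims v' , proj₂ ν v' , proj₁ (proj₂ (leastSim sims v'))
        where
        below : Subset (El U)
        below = ⟦ (_⊏ u) ⟧
        sims : (v : El below) → Σ[ α ∈ K ] proj₁ v ⊑ α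
        sims (v , p) = rankedAt v (rs (⟦⟧-elim p))
        -- `rank` embeds `below` in κ, and κ does not embed in `below`, as it would then embed in
        -- `U`.
        ν = bound (mk↣ {to = rank sims} (λ e → El-≡ (rank-injective sims e)) ,
                   λ i → K⋠U (injection i (mk↣ {to = proj₁} El-≡)))
                  (rank sims)
      ranked : ∀ u → Σ[ α ∈ K ] u ⊑ α
      ranked u = rankedAt u (On.wellFounded proj₁ wellFounded u)

    ⋃ᶠ : {I : Set ℓ} → (I → Subset L) → Subset L
    ⋃ᶠ {I} t = ⟦ (λ y → Σ[ i ∈ I ] y ∈ t i) ⟧

    abstract
      ⋃ᶠ-small : {I : Set ℓ} → I ≺ K → (t : I → Subset L) →
        (∀ i → El (t i) ≺ K) → El (⋃ᶠ t) ≺ K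
      ⋃ᶠ-small {I} I≺K t t≺K = ⋡⇒≺ (⋃ᶠ t) K⋠⋃
        where
        -- An injection of K splits K into fewer than κ many sets y i of size less
        -- than κ.  All of them are bounded, by regularity, and so is their union.
        K⋠⋃ : ¬ (K ≼ El (⋃ᶠ t))
        K⋠⋃ e = ≤-refl (<-trans (proj₂ (β i) (k , y∈)) (proj₂ β* i))
          where
          module e = Injection e
          y : I → Subset K
          y i k = t i (proj₁ (e.to k))
          β : (i : I) → Σ[ ν ∈ K ] ((k : El (y i)) → proj₁ k <ᴷ ν)
          β i = bound (≺-respˡ-≼ (mk↣ {to = λ (k , p) → proj₁ (e.to k) , p}
            λ q → El-≡ (e.injective (El-≡ (cong proj₁ q)))) (t≺K i)) proj₁
          β* : Σ[ ν ∈ K ] (∀ i → proj₁ (β i) <ᴷ ν)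
          β* = bound I≺K (proj₁ ∘ β)
          -- The common bound k itself lies in some `y i`, whence k < β(i) < k.
          k : K
          k = proj₁ β*
          i : I
          i = proj₁ (⟦⟧-elim (proj₂ (e.to k)))
          y∈ : k ∈ y i
          y∈ = proj₂ (⟦⟧-elim (proj₂ (e.to k)))

    Two : Set ℓ
    Two = Lift ℓ (Fin 2)

    pattern first  = lift zero
    pattern second = lift (suc zero)

    pair : {A : Set ℓ} → A → A → Two → A
    pair x y first  = x
    pair x y second = y

    abstract
      Two≺K : Two ≺ K
      Two≺K = injection (mk↣ {to = toℕ ∘ lower} λ e → cong lift (toℕ-injective e))
                        (proj₁ isRegular) ,
              λ i → let open Injection (injection (proj₁ isRegular) i) using (to; injective)
                    in ℕ→Fin-notInjective (lower ∘ to) (injective ∘ cong lift)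

      bound₂ : (α β : K) → Σ[ ν ∈ K ] α <ᴷ ν × β <ᴷ ν
      bound₂ α β = let ν , p = bound Two≺K (pair α β) in ν , p first , p second

    -- Elements of P_κ(λ), suprema and trimming.

    𝒫-intro : {a : Subset L} → El a ≺ K → a ∈ 𝒫
    𝒫-intro s = ⟦⟧-intro ((λ _ _ → _) , s)

    𝒫-elim : {a : Subset L} → a ∈ 𝒫 → El a ≺ K
    𝒫-elim m = proj₂ (⟦⟧-elim m)

    𝒫-down : {a b : Subset L} → a ⊆ b → b ∈ 𝒫 → a ∈ 𝒫
    𝒫-down i m = 𝒫-intro (≺-respˡ-≼ (El-mono i) (𝒫-elim m))

    infixr 6 _∪_
    _∪_ : Subset L → Subset L → Subset L
    a ∪ b = ⋃ᶠ (pair a b)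

    ∪-introˡ : ∀ {a b} → a ⊆ a ∪ b
    ∪-introˡ x p = ⟦⟧-intro (first , p)

    ∪-introʳ : ∀ {a b} → b ⊆ a ∪ b
    ∪-introʳ x p = ⟦⟧-intro (second , p)

    ∪-elim : ∀ {a b x} → x ∈ a ∪ b → x ∈ a ⊎ x ∈ b
    ∪-elim p with ⟦⟧-elim p
    ... | first , q = inj₁ q
    ... | second , q = inj₂ q

    ∪-𝒫 : ∀ {a b} → a ∈ 𝒫 → b ∈ 𝒫 → a ∪ b ∈ 𝒫
    ∪-𝒫 p q = 𝒫-intro (⋃ᶠ-small Two≺K _
      λ { first → 𝒫-elim p ; second → 𝒫-elim q })

    ｛_｝ : L → Subset L
    ｛ γ ｝ = ⟦ (_≡ γ) ⟧

    ｛｝-𝒫 : ∀ γ → ｛ γ ｝ ∈ 𝒫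
    ｛｝-𝒫 γ = 𝒫-intro (≺-respˡ-≼
      (mk↣ {to = λ _ → first} λ { {_ , p} {_ , q} _ →
        El-≡ (trans (⟦⟧-elim p) (sym (⟦⟧-elim q))) }) Two≺K)

    abstract
      boundBelowκ : (a : Subset L) → a ∈ 𝒫 →
        Σ[ ν ∈ K ] (∀ γ → γ ∈ a → γ < κ → γ < proj₁ ν)
      boundBelowκ a m =
        let ν , p = bound (≺-respˡ-≼ (El-mono λ x q → proj₁ (∩-elim a (seg κ) q)) (𝒫-elim m))
                          (λ (x , q) → x , proj₂ (∩-elim a (seg κ) q))
        in ν , λ γ γ∈a γ<κ → p (γ , ∩-intro a (seg κ) γ∈a (⟦⟧-intro γ<κ))

      -- The least upper bound of a ∩ κ serves: a smaller β is not an upper bound, so it lies in ⋃(a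
      -- ∩ κ).
      sup : (a : Subset L) → a ∈ 𝒫 → Σ[ α ∈ K ] seg (proj₁ α) ≡ ⋃ (a ∩ seg κ)
      sup a m = (α , ⟦⟧-intro α<κ) , ⊆-antisym ⊆₁ ⊆₂
        where
        Upper : L → Set ℓ
        Upper α = ∀ γ → γ ∈ a ∩ seg κ → γ ≤ α
        ν : K
        ν = proj₁ (boundBelowκ a m)
        ν-upper : Upper (proj₁ ν)
        ν-upper γ p = <⇒≤ (proj₂ (boundBelowκ a m) γ (proj₁ (∩-elim a (seg κ) p))
          (⟦⟧-elim (proj₂ (∩-elim a (seg κ) p))))
        leastUpper : Σ[ α ∈ L ] Upper α × (∀ β → β < α → ¬ Upper β)
        leastUpper = least wellFounded Upper (proj₁ ν , ν-upper)
        α : L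
        α = proj₁ leastUpper
        α<κ : α < κ
        α<κ = ≤-<-trans (λ ν<α → proj₂ (proj₂ leastUpper) _ ν<α ν-upper)
                        (⟦⟧-elim (proj₂ ν))
        ⊆₁ : seg α ⊆ ⋃ (a ∩ seg κ)
        ⊆₁ β p = ⟦⟧-intro (by-contradiction λ n →
          proj₂ (proj₂ leastUpper) β (⟦⟧-elim p) λ γ q r → n (γ , q , r))
        ⊆₂ : ⋃ (a ∩ seg κ) ⊆ seg α
        ⊆₂ β p = let γ , q , β<γ = ⟦⟧-elim p
                 in ⟦⟧-intro (<-≤-trans β<γ (proj₁ (proj₂ leastUpper) γ q))

    ∈-⋃ : ∀ b (α δ : K) → proj₁ δ ∈ b → α <ᴷ δ → proj₁ α ∈ ⋃ (b ∩ seg κ)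
    ∈-⋃ b α δ δ∈b α<δ = ⟦⟧-intro (proj₁ δ , ∩-intro b (seg κ) δ∈b (proj₂ δ) , α<δ)

    -- Otherwise the supremum would belong to ⋃(a ∩ κ) and so be less than itself.
    sup-upper : ∀ {a} (m : a ∈ 𝒫) {γ : K} → proj₁ γ ∈ a → γ ≤ᴷ proj₁ (sup a m)
    sup-upper {a} m {γ} p sup<γ = ≤-refl (⟦⟧-elim
      (subst (proj₁ (proj₁ (sup a m)) ∈_) (sym (proj₂ (sup a m)))
        (∈-⋃ a (proj₁ (sup a m)) γ p sup<γ)))

    []²-intro : ∀ {B a b} (m : a ∈ 𝒫) → a ∈ B → b ∈ B →
      proj₁ (proj₁ (sup a m)) ∈ ⋃ (b ∩ seg κ) →
      (proj₁ (proj₁ (sup a m)) , b) ∈ [_]² Λ κ B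
    []²-intro {a = a} m a∈B b∈B sup∈⋃ = ⟦⟧-intro (a , a∈B , b∈B , proj₂ (sup a m) , sup∈⋃)

    -- b without max(b ∩ κ), if that exists.  It allows enlarging ⋃(b ∩ κ), by a
    -- new maximum, without changing trim b.
    trim : Subset L → Subset L
    trim b = ⟦ (λ β → β ∈ b × (β < κ → Σ[ γ ∈ L ] γ ∈ b × γ < κ × β < γ)) ⟧

    trim-⊆ : ∀ b → trim b ⊆ b
    trim-⊆ b x p = proj₁ (⟦⟧-elim p)

    -- An element of a below κ is not max(b ∩ κ), since γ ∈ b lies above it.
    ⊆-trim : ∀ {a b} {γ : K} → a ⊆ b → proj₁ γ ∈ b →
      (∀ β → β ∈ a → β < κ → β < proj₁ γ) → a ⊆ trim b
    ⊆-trim {γ = γ , q} i γ∈b u β β∈a =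
      ⟦⟧-intro (i β β∈a , λ β<κ → γ , γ∈b , ⟦⟧-elim q , u β β∈a β<κ)

    abstract
      -- γ is the maximum of (a ∪ {γ}) ∩ κ, hence exactly what `trim` removes.
      trim-∪ : ∀ a (γ : K) → (∀ β → β ∈ a → β < κ → β < proj₁ γ) →
        trim (a ∪ ｛ proj₁ γ ｝) ≡ a
      trim-∪ a (γ , q) u = ⊆-antisym ⊆₁
        (⊆-trim {γ = γ , q} ∪-introˡ (∪-introʳ γ (⟦⟧-intro refl)) u)
        where
        γ<κ : γ < κ
        γ<κ = ⟦⟧-elim q
        δ≤γ : ∀ δ → δ ∈ a ∪ ｛ γ ｝ → δ < κ → δ ≤ γ
        δ≤γ δ δ∈ δ<κ with ∪-elim δ∈
        ... | inj₁ δ∈a = <⇒≤ (u δ δ∈a δ<κ)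
        ... | inj₂ δ≡γ = subst (_≤ γ) (sym (⟦⟧-elim δ≡γ)) ≤-refl
        γ∉trim : ¬ (γ ∈ trim (a ∪ ｛ γ ｝))
        γ∉trim p = let δ , δ∈ , δ<κ , γ<δ = proj₂ (⟦⟧-elim p) γ<κ in δ≤γ δ δ∈ δ<κ γ<δ
        ⊆₁ : trim (a ∪ ｛ γ ｝) ⊆ a
        ⊆₁ β p with ∪-elim (trim-⊆ (a ∪ ｛ γ ｝) β p)
        ... | inj₁ β∈a = β∈a
        ... | inj₂ β≡γ = ⊥-elim (γ∉trim (subst (_∈ trim (a ∪ ｛ γ ｝)) (⟦⟧-elim β≡γ) p))

      I⁺-cofinal : ∀ {B} → I⁺ Λ κ B → ∀ a → a ∈ 𝒫 → Σ[ b ∈ Subset L ] b ∈ B × a ⊆ b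
      I⁺-cofinal (B⊆ , ¬I) a m = by-contradiction λ n →
        ¬I (B⊆ , a , m , λ (b , b∈B , _ , a⊆b) → n (b , b∈B , a⊆b))

    -- Levels of ordinals below κ.

    -- With h ξ the supremum of the φ t ξ, the relation R β α says that h ≤ α on
    -- [0 , β], and the level of α is its R-rank.
    module Levels {I : Set ℓ} (I≺K : I ≺ K) (φ : I → K → K) where

      R : Rel K ℓ
      R β α = ∀ t ζ → ζ ≤ᴷ β → φ t ζ ≤ᴷ α

      Reaches : K → K → Set ℓ
      Reaches = Sim _<ᴷ_ R

      -- A relation, since an α that reaches every i has no level; for empty `I` this is so for all
      -- α.
      Level-of : K → K → Set ℓ
      Level-of α i = Reaches i α × (∀ i' → i <ᴷ i' → ¬ Reaches i' α)

      reaches-mono : ∀ {i α β} → Reaches i α → α ≤ᴷ β → Reaches i β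
      reaches-mono (sim s) α≤β = sim λ j j<i →
        let ξ , r , s' = s j j<i
        in ξ , (λ t ζ ζ≤ξ β<φ → r t ζ ζ≤ξ (≤-<-trans α≤β β<φ)) , s'

      below-small : (i : K) → El ⟦ (_<ᴷ i) ⟧ ≺ K
      below-small i = ≺-respˡ-≼
        (mk↣ {to = λ (k , p) → proj₁ k , ⟦⟧-intro (⟦⟧-elim p)}
          λ e → El-≡ (El-≡ (cong proj₁ e)))
        (isCardinal (proj₁ i) (⟦⟧-elim (proj₂ i)))

      abstract
        -- By recursion on i: `ξ*` bounds ordinals reaching the j < i, `η t` bounds `φ t` below
        -- `ξ*`, and `α` bounds all `η t`, so `R` holds between each `ξ j` and `α`.
        reachesAt : ∀ i → Acc _<ᴷ_ i → Σ[ α ∈ K ] Reaches i α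
        reachesAt i (acc rs) = proj₁ α , sim λ j j<i →
            let j' = j , ⟦⟧-intro j<i in
            proj₁ (ξ j') ,
            (λ t ζ ζ≤ξ → <⇒≤ (<-trans
              (proj₂ (η t) (ζ , ⟦⟧-intro (≤-<-trans ζ≤ξ (proj₂ ξ* j')))) (proj₂ α t))) ,
            proj₂ (ξ j')
          where
          ξ : (j : El ⟦ (_<ᴷ i) ⟧) → Σ[ α ∈ K ] Reaches (proj₁ j) α
          ξ (j , p) = reachesAt j (rs (⟦⟧-elim p))
          ξ* : Σ[ ν ∈ K ] (∀ j → proj₁ (ξ j) <ᴷ ν)
          ξ* = bound (below-small i) (proj₁ ∘ ξ)
          η : (t : I) → Σ[ ν ∈ K ] ((ζ : El ⟦ (_<ᴷ proj₁ ξ*) ⟧) → φ t (proj₁ ζ) <ᴷ ν)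
          η t = bound (below-small (proj₁ ξ*)) (φ t ∘ proj₁)
          α : Σ[ ν ∈ K ] (∀ t → proj₁ (η t) <ᴷ ν)
          α = bound I≺K (proj₁ ∘ η)

      reaches : ∀ i → Σ[ α ∈ K ] Reaches i α
      reaches i = reachesAt i (<ᴷ-wellFounded i)

      level-unique : ∀ {α i j} → Level-of α i → Level-of α j → i ≡ j
      level-unique {i = i} {j} (r , n) (r' , n') with compare (proj₁ i) (proj₁ j)
      ... | tri< i<j _ _ = ⊥-elim (n j i<j r')
      ... | tri≈ _ e _ = El-≡ e
      ... | tri> _ _ j<i = ⊥-elim (n' i j<i r)

      abstract
        -- Some ν reaches an i' > i, so by monotonicity no α ≥ ν has level i.
        level-bounded : ∀ i → Σ[ ν ∈ K ] (∀ α → Level-of α i → α <ᴷ ν)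
        level-bounded i =
          let i' , i<i' , _ = bound₂ i i
              ν , r = reaches i'
          in ν , λ α (_ , n) → by-contradiction λ ν≤α → n i' i<i' (reaches-mono r ν≤α)

        -- Take the least ξ reaching i. Were i' > i reached by some α < φ t ξ, a β with `R β α`
        -- would reach i; then β ≥ ξ, so φ t ξ ≤ α.
        level-interval : ∀ i → Σ[ ξ ∈ K ]
          (∀ α t → ξ ≤ᴷ α → α <ᴷ φ t ξ → Level-of α i)
        level-interval i =
          let ξ , r , ξ-least = least <ᴷ-wellFounded (Reaches i) (reaches i)
          in ξ , λ α t ξ≤α α<φ → reaches-mono r ξ≤α , λ i' i<i' r' →
            let β , β-R-α , s = unsim r' i i<i'
            in ξ-least β (by-contradiction λ ξ≤β → β-R-α t ξ ξ≤β α<φ) s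

    -- The colouring and the set A.

    module Colouring {C : Set ℓ} (c₀ : C) (𝒯 : Subset (Subset L))
      (𝒯-small : ∀ a → a ∈ 𝒫 → El (𝒯 ∩ ⟦ (λ t → t ⊆ a) ⟧) ≺ K)
      (φ : El 𝒯 → K → K) (θ : El 𝒯 → C) where

      𝒯⟨_⟩ : Subset L → Subset (Subset L)
      𝒯⟨ a ⟩ = 𝒯 ∩ ⟦ (λ t → t ⊆ a) ⟧

      forget : ∀ {a} → El 𝒯⟨ a ⟩ → El 𝒯
      forget {a} (t , p) = t , proj₁ (∩-elim 𝒯 ⟦ (λ t → t ⊆ a) ⟧ p)

      restrict : ∀ {a} (t : El 𝒯) → proj₁ t ⊆ a → El 𝒯⟨ a ⟩
      restrict {a} (t , p) t⊆a = t , ∩-intro 𝒯 ⟦ (λ t → t ⊆ a) ⟧ p (⟦⟧-intro t⊆a)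

      forget-restrict : ∀ {a} t (t⊆a : proj₁ t ⊆ a) → forget (restrict t t⊆a) ≡ t
      forget-restrict t t⊆a = El-≡ refl

      module Lv {a : Subset L} (m : a ∈ 𝒫) = Levels (𝒯-small a m) (φ ∘ forget)
      -- Its injectivity is what assigns different levels to different members of `𝒯⟨ a ⟩`.
      module Index {a : Subset L} (m : a ∈ 𝒫) = Injection (proj₁ (𝒯-small a m))

      AtLevel : ∀ {a} → a ∈ 𝒫 → El 𝒯⟨ a ⟩ → K → Set ℓ
      AtLevel m t α = Lv.Level-of m α (Index.to m t)

      atLevel-unique : ∀ {a} {m n : a ∈ 𝒫} {t u α} →
        AtLevel m t α → AtLevel n u α → t ≡ u
      atLevel-unique {m = m} {n} p q with T-irrelevant m n
      ... | refl = Index.injective m (Lv.level-unique m p q)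

      -- The equations let α and t range over all of λ and 𝒯; nothing is hit when α ≥ κ or t is not
      -- contained in `trim b`.
      Hit : L → Subset L → El 𝒯 → Set ℓ
      Hit α b t = Σ[ m ∈ trim b ∈ 𝒫 ] Σ[ u ∈ El 𝒯⟨ trim b ⟩ ] Σ[ β ∈ K ]
        proj₁ β ≡ α × forget u ≡ t × AtLevel m u β

      hit-unique : ∀ {α b t t'} → Hit α b t → Hit α b t' → t ≡ t'
      hit-unique (_ , _ , β , refl , refl , p) (_ , _ , β' , e , refl , q)
        with El-≡ {x = β'} {β} e
      ... | refl = cong forget (atLevel-unique p q)

      colour : L → Subset L → C
      colour α b with lem {Σ (El 𝒯) (Hit α b)}
      ... | yes (t , _) = θ t
      -- No t is hit: the value is an arbitrary default.
      ... | no _ = c₀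

      colour-hit : ∀ {α b t} → Hit α b t → colour α b ≡ θ t
      colour-hit {α} {b} {t} h with lem {Σ (El 𝒯) (Hit α b)}
      ... | yes (_ , h') = cong θ (hit-unique h' h)
      ... | no n = ⊥-elim (n (t , h))

      Bounds : K → Subset L → Set ℓ
      Bounds γ a = ∀ (m : a ∈ 𝒫) t α → AtLevel m t α → α <ᴷ γ

      A : Subset (Subset L)
      A = ⟦ (λ b → b ∈ 𝒫 × (Σ[ γ ∈ K ] proj₁ γ ∈ b × Bounds γ (trim b))) ⟧

      abstract
        -- Fewer than κ levels are assigned and each is bounded. Allowing every γ > ν lets γ be
        -- chosen above a ∩ κ as well.
        bounds : ∀ {a} → a ∈ 𝒫 → Σ[ ν ∈ K ] (∀ γ → ν <ᴷ γ → Bounds γ a)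
        bounds {a} m = proj₁ ν , λ γ ν<γ m' t α l → <-trans
            (proj₂ (level t) α (subst (λ m → AtLevel m t α) (T-irrelevant m' m) l))
            (<-trans (proj₂ ν t) ν<γ)
          where
          level : (t : El 𝒯⟨ a ⟩) → Σ[ ν ∈ K ] (∀ α → AtLevel m t α → α <ᴷ ν)
          level t = Lv.level-bounded m (Index.to m t)
          ν : Σ[ ν ∈ K ] (∀ t → proj₁ (level t) <ᴷ ν)
          ν = bound (𝒯-small a m) (proj₁ ∘ level)

      -- Add to a an ordinal γ that exceeds a ∩ κ, so that `trim b` is a, and also exceeds all
      -- levels assigned with respect to a.
      A-cofinal : ∀ a → a ∈ 𝒫 → Σ[ b ∈ Subset L ] b ∈ A × b ∈ 𝒫 × a ⊆ b
      A-cofinal a m = b , b∈A , b∈𝒫 , ∪-introˡ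
        where
        ν ν' : K
        ν = proj₁ (boundBelowκ a m)
        ν' = proj₁ (bounds m)
        γ : Σ[ γ ∈ K ] ν <ᴷ γ × ν' <ᴷ γ
        γ = bound₂ ν ν'
        γ₀ : K
        γ₀ = proj₁ γ
        b : Subset L
        b = a ∪ ｛ proj₁ γ₀ ｝
        b∈𝒫 : b ∈ 𝒫
        b∈𝒫 = ∪-𝒫 m (｛｝-𝒫 (proj₁ γ₀))
        trim≡ : trim b ≡ a
        trim≡ = trim-∪ a γ₀ λ β β∈a β<κ →
          <-trans (proj₂ (boundBelowκ a m) β β∈a β<κ) (proj₁ (proj₂ γ))
        b∈A : b ∈ A
        b∈A = ⟦⟧-intro (b∈𝒫 , γ₀ , ∪-introʳ (proj₁ γ₀) (⟦⟧-intro refl) ,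
          subst (Bounds γ₀) (sym trim≡) (proj₂ (bounds m) γ₀ (proj₂ (proj₂ γ))))

      A-I⁺ : I⁺ Λ κ A
      A-I⁺ = (λ b p → proj₁ (⟦⟧-elim p)) , λ (_ , a , m , n) → n (A-cofinal a m)

      -- This gives the condition α < ⋃(b ∩ κ) in `[_]²`.
      A-∋ : ∀ {b} → b ∈ A → (m : trim b ∈ 𝒫) → ∀ t α → AtLevel m t α →
        proj₁ α ∈ ⋃ (b ∩ seg κ)
      A-∋ {b} b∈A m t α l =
        let _ , γ , γ∈b , γ-bounds = ⟦⟧-elim b∈A
        in ∈-⋃ b α γ γ∈b (γ-bounds m t α l)

      -- Attaining every colour on B.

      module _ {X : Subset (K → K)} (X-dominating : Dominating Λ κ X)
        (φ-onto : ∀ f → f ∈ X → Σ[ t ∈ El 𝒯 ] φ t ≡ f)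
        (𝒯⊆𝒫 : 𝒯 ⊆ 𝒫)
        {B : Subset (Subset L)} (B-I⁺ : I⁺ Λ κ B) (B⊆A : B ⊆ A) where

        B⊆𝒫 : B ⊆ 𝒫
        B⊆𝒫 = proj₁ B-I⁺

        supB : (b : El B) → K
        supB (b , p) = proj₁ (sup b (B⊆𝒫 b p))

        supB-unbounded : ∀ ξ → Σ[ b ∈ El B ] ξ ≤ᴷ supB b
        supB-unbounded ξ =
          let b , b∈B , ξ⊆b = I⁺-cofinal B-I⁺ ｛ proj₁ ξ ｝ (｛｝-𝒫 (proj₁ ξ))
          in (b , b∈B) , sup-upper (B⊆𝒫 b b∈B) {ξ} (ξ⊆b (proj₁ ξ) (⟦⟧-intro refl))

        Attained : El 𝒯 → Set ℓ
        Attained t =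
          Σ[ (α , b) ∈ (L × Subset L) ] (α , b) ∈ [_]² Λ κ B × colour α b ≡ θ t

        attained-at : ∀ t b → b ∈ B → (m : trim b ∈ 𝒫) (t⊆b : proj₁ t ⊆ trim b) →
          (b₁ : El B) → AtLevel m (restrict t t⊆b) (supB b₁) → Attained t
        attained-at t b b∈B m t⊆b (b₁ , b₁∈B) l =
          (proj₁ (supB (b₁ , b₁∈B)) , b) ,
          []²-intro (B⊆𝒫 b₁ b₁∈B) b₁∈B b∈B (A-∋ (B⊆A b b∈B) m _ _ l) ,
          colour-hit (m , restrict t t⊆b , _ , refl , forget-restrict t t⊆b , l)

        -- Cofinality is applied to a with an ordinal above a ∩ κ added, so that trimming removes
        -- nothing of a.
        absorb : ∀ a → a ∈ 𝒫 → Σ[ b ∈ Subset L ] b ∈ B × trim b ∈ 𝒫 × a ⊆ trim b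
        absorb a m =
          let γ , γ-bound = boundBelowκ a m
              b , b∈B , a∪γ⊆b = I⁺-cofinal B-I⁺ (a ∪ ｛ proj₁ γ ｝)
                (∪-𝒫 m (｛｝-𝒫 (proj₁ γ)))
          in b , b∈B , 𝒫-down (trim-⊆ b) (B⊆𝒫 b b∈B) ,
             ⊆-trim {γ = γ} (λ y p → a∪γ⊆b y (∪-introˡ y p))
                    (a∪γ⊆b (proj₁ γ) (∪-introʳ (proj₁ γ) (⟦⟧-intro refl))) γ-bound

        next : K → K
        next ξ = supB (proj₁ (supB-unbounded ξ))

        attained-in : ∀ t b → b ∈ B → trim b ∈ 𝒫 → proj₁ t ⊆ trim b →
          (∀ ξ → Σ[ s ∈ El 𝒯 ] proj₁ s ⊆ trim b × next ξ <ᴷ φ s ξ) → Attained t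
        attained-in t b b∈B m t⊆b dominates =
          let ξ , interval = Lv.level-interval m (Index.to m (restrict t t⊆b))
              -- This is the witness used in `next`, so `supB b₁` is `next ξ`.
              b₁ , ξ≤sup = supB-unbounded ξ
              s , s⊆b , sup<φ = dominates ξ
          in attained-at t b b∈B m t⊆b b₁
               (interval (supB b₁) (restrict s s⊆b) ξ≤sup
                 (subst (λ r → supB b₁ <ᴷ φ r ξ) (sym (forget-restrict s s⊆b)) sup<φ))

        codes : (x : Subset (K → K)) → x ∈ Pow< K X →
          Σ[ a ∈ Subset L ] a ∈ 𝒫 ×
            (∀ f → f ∈ x → Σ[ s ∈ El 𝒯 ] proj₁ s ⊆ a × φ s ≡ f)
        codes x x∈ = ⋃ᶠ (proj₁ ∘ code) ,
          𝒫-intro (⋃ᶠ-small (proj₂ (⟦⟧-elim x∈)) (proj₁ ∘ code)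
            λ f → 𝒫-elim (𝒯⊆𝒫 _ (proj₂ (code f)))) ,
          λ f f∈x → code (f , f∈x) , (λ y p → ⟦⟧-intro ((f , f∈x) , p)) ,
            proj₂ (φ-onto f (proj₁ (⟦⟧-elim x∈) f f∈x))
          where
          code : El x → El 𝒯
          code (f , f∈x) = proj₁ (φ-onto f (proj₁ (⟦⟧-elim x∈) f f∈x))

        attained : ∀ t → Attained t
        attained t =
          let x , x∈ , x-dominates = X-dominating next
              c , c∈𝒫 , c-codes = codes x x∈
              -- Having c inside `trim b` makes h exceed `next` everywhere; having t inside gives t
              -- a level.
              b , b∈B , m , t∪c⊆b = absorb (proj₁ t ∪ c) (∪-𝒫 (𝒯⊆𝒫 _ (proj₂ t)) c∈𝒫)
          in attained-in t b b∈B m (λ y p → t∪c⊆b y (∪-introˡ y p)) λ ξ →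
               let f , f∈x , next<f = x-dominates ξ
                   s , s⊆c , φs≡f = c-codes f f∈x
               in s , (λ y p → t∪c⊆b y (∪-introʳ y (s⊆c y p))) ,
                  subst (λ h → next ξ <ᴷ h ξ) (sym φs≡f) next<f

    []²-mono : ∀ {A B} → A ⊆ B → [_]² Λ κ A ⊆ [_]² Λ κ B
    []²-mono i (α , b) p =
      let a , a∈ , b∈ , eq , α∈ = ⟦⟧-elim p
      in ⟦⟧-intro (a , i a a∈ , i b b∈ , eq , α∈)

theorem14p2 : ∀ {ℓ : Level} (lem : ExcludedMiddle ℓ) → Extensionality ℓ ℓ →
    let open Classical lem in
    (Λ : Cardinal) (κ : Cardinal.Carrier Λ) →
    IsCardinal Λ κ → IsRegular Λ κ → IsUncountable Λ κ →
    (ρ δ : Cardinal) → 𝒦 Λ κ ρ → Is𝔡̄ Λ κ δ →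
    Cardinal.Carrier δ ≼ Cardinal.Carrier ρ →
    ¬ Arrow Λ κ ρ
theorem14p2 lem ext Λ κ isCardinal isRegular _ ρ δ
  (L≼ρ , 𝒯 , 𝒯⊆𝒫 , 𝒯⤖ρ , 𝒯-small) ((X , X-dominating , X⤖δ) , _) δ≼ρ arrow =
  let B , B-I⁺ , B⊆A , ¬onto = arrow F A A-I⁺
  in ¬onto λ c →
    let t , θt≡c = Bijection.strictlySurjective 𝒯⤖ρ c
        p , p∈ , e = attained X-dominating φ-onto 𝒯⊆𝒫 B-I⁺ B⊆A t
    in (p , []²-mono (proj₁ B-I⁺) p p∈) , p∈ , trans e θt≡c
  where
  open Classical lem
  open Reasoning lem ext
  open Regular Λ κ isCardinal isRegular
  X≼𝒯 : El X ≼ El 𝒯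
  X≼𝒯 = injection (Bijection.injection X⤖δ)
    (injection δ≼ρ (Bijection.injection (⤖-sym 𝒯⤖ρ)))
  inhabitant : El X
  inhabitant =
    -- Dominating any function at any point requires a member of X; the identity and the image of 0
    -- serve.
    let _ , x∈ , dominates = X-dominating (λ α → α)
        f , f∈x , _ = dominates (Injection.to (proj₁ isRegular) 0)
    in f , proj₁ (⟦⟧-elim x∈) f f∈x
  surjection : Σ[ r ∈ (El 𝒯 → El X) ] (∀ f → Σ[ t ∈ El 𝒯 ] r t ≡ f)
  surjection = retraction X≼𝒯 inhabitant
  φ : El 𝒯 → K → K
  φ t = proj₁ (proj₁ surjection t)
  φ-onto : ∀ f → f ∈ X → Σ[ t ∈ El 𝒯 ] φ t ≡ f
  φ-onto f p = let t , e = proj₂ surjection (f , p) in t , cong proj₁ e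
  -- The element of ρ given by κ ∈ λ is the default colour.
  open Colouring (Injection.to L≼ρ κ) 𝒯 𝒯-small φ (Bijection.to 𝒯⤖ρ)
  F : El ([_]² Λ κ (Pκλ Λ κ)) → Cardinal.Carrier ρ
  F ((α , b) , _) = colour α b
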